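{- Let $n,m,k,l\in\mathbb{Z}^+$ and $L\in\mathsf{NExt}(\mathsf{S4BP}^{k,\omega}_{n,m})$. Then $L$ is Kripke complete. Moreover, if $L\in\mathsf{NExt}(\mathsf{S4BP}^{k,l}_{n,m})$, then $L$ has the finite model property.
   Context: Tense formulas use $\Box$, $\Diamond=\neg\Box\neg$ and a past possibility operator written here $\mathsf{P}$; $\mathsf{S4}_t=\mathsf{K}_t\oplus\{\Box p\to p,\Box p\to\Box\Box p\}$; $\mathsf{NExt}(L)$ is the set of tense logics extending $L$. With $\Delta\phi=\phi\vee\Diamond\phi\vee\mathsf{P}\phi$, $\Delta^{j+1}\phi=\Delta\Delta^j\phi$: $\mathbf{bz}_l=\Delta^{l+1}p\to\Delta^lp$, $\mathbf{bz}_\omega=\top$; $\mathbf{bw}^+_n=\bigwedge_{i\leq n}\Diamond p_i\to\bigvee_{i\neq j\leq n}\Diamond(p_i\wedge(p_j\vee\Diamond p_j))$; $\mathbf{bw}^-_m$ the same with $\mathsf{P}$ for $\Diamond$; $\mathbf{bd}_1=\Diamond\Box p_0\to p_0$, $\mathbf{bd}_{j+1}=\Diamond(\Box p_j\wedge\neg\mathbf{bd}_j)\to p_j$. $\mathsf{S4BP}^{k,l}_{n,m}=\mathsf{S4}_t\oplus\{\mathbf{bd}_k,\mathbf{bz}_l,\mathbf{bw}^+_n,\mathbf{bw}^-_m\}$. $L$ is Kripke complete if it is the logic of a class of Kripke frames, and has the finite model property if it is the logic of a class of finite frames. -}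

module Defs where

open import Level using (0ℓ) renaming (suc to lsuc)
open import Data.Nat using (ℕ; zero; suc; _≟_)
open import Data.List using (List; []; _∷_; upTo; filter; map; concatMap)
open import Data.Maybe using (Maybe; just; nothing)
open import Data.Product using (Σ; _×_)
open import Data.Empty renaming (⊥ to Empty)
open import Data.Fin using (Fin)
open import Function.Bundles using (_↔_)
open import Relation.Nullary using (¬?)

-- Tense formulas.  Primitives: variables, falsum, implication,
-- □ (future necessity, G) and ■ (past necessity, H).

infixr 5 _⇒_
infix 8 ~_
infixr 6 _∨'_
infixr 7 _∧'_

data Fm : Set where
  var : ℕ → Fm
  ⊥'  : Fm
  _⇒_ : Fm → Fm → Fm
  □   : Fm → Fm
  ■   : Fm → Fm

~_ : Fm → Fm
~ A = A ⇒ ⊥'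

⊤' : Fm
⊤' = ~ ⊥'

_∨'_ : Fm → Fm → Fm
A ∨' B = (~ A) ⇒ B

_∧'_ : Fm → Fm → Fm
A ∧' B = ~ (A ⇒ ~ B)

◇ : Fm → Fm
◇ A = ~ □ (~ A)

𝐏 : Fm → Fm
𝐏 A = ~ ■ (~ A)

_[_] : Fm → (ℕ → Fm) → Fm
var i   [ σ ] = σ i
⊥'      [ σ ] = ⊥'
(A ⇒ B) [ σ ] = (A [ σ ]) ⇒ (B [ σ ])
□ A     [ σ ] = □ (A [ σ ])
■ A     [ σ ] = ■ (A [ σ ])

data KtAx : Fm → Set where
  ax-K    : ∀ A B → KtAx (A ⇒ (B ⇒ A))
  ax-S    : ∀ A B C → KtAx ((A ⇒ (B ⇒ C)) ⇒ ((A ⇒ B) ⇒ (A ⇒ C)))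
  ax-DN   : ∀ A → KtAx ((~ ~ A) ⇒ A)
  ax-K□   : ∀ A B → KtAx (□ (A ⇒ B) ⇒ (□ A ⇒ □ B))
  ax-K■   : ∀ A B → KtAx (■ (A ⇒ B) ⇒ (■ A ⇒ ■ B))
  ax-conv□ : ∀ A → KtAx (A ⇒ □ (𝐏 A))
  ax-conv■ : ∀ A → KtAx (A ⇒ ■ (◇ A))

record NormalTenseLogic (L : Fm → Set) : Set where
  field
    axioms : ∀ A → KtAx A → L A
    mp     : ∀ A B → L (A ⇒ B) → L A → L B
    nec□   : ∀ A → L A → L (□ A)
    nec■   : ∀ A → L A → L (■ A)
    subst  : ∀ A σ → L A → L (A [ σ ])

data KtPlus (Γ : Fm → Set) : Fm → Set where
  gen   : ∀ {A} → Γ A → KtPlus Γ A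
  ax    : ∀ {A} → KtAx A → KtPlus Γ A
  mp    : ∀ {A B} → KtPlus Γ (A ⇒ B) → KtPlus Γ A → KtPlus Γ B
  nec□  : ∀ {A} → KtPlus Γ A → KtPlus Γ (□ A)
  nec■  : ∀ {A} → KtPlus Γ A → KtPlus Γ (■ A)
  subst : ∀ {A} σ → KtPlus Γ A → KtPlus Γ (A [ σ ])

NExt : (Γ : Fm → Set) → (L : Fm → Set) → Set
NExt Γ L = NormalTenseLogic L × (∀ A → KtPlus Γ A → L A)

p : ℕ → Fm
p = var

⋀ : List Fm → Fm
⋀ []       = ⊤'
⋀ (A ∷ []) = A
⋀ (A ∷ As) = A ∧' ⋀ As

⋁ : List Fm → Fm
⋁ []       = ⊥'
⋁ (A ∷ []) = A
⋁ (A ∷ As) = A ∨' ⋁ As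

Δ : Fm → Fm
Δ A = (A ∨' ◇ A) ∨' 𝐏 A

Δ^ : ℕ → Fm → Fm
Δ^ zero A    = A
Δ^ (suc j) A = Δ (Δ^ j A)

-- bz_l for l ∈ ℕ (just l), bz_ω = ⊤ (nothing)
bz : Maybe ℕ → Fm
bz (just l) = Δ^ (suc l) (p 0) ⇒ Δ^ l (p 0)
bz nothing  = ⊤'

idx : ℕ → List ℕ
idx n = upTo (suc n)

bwWith : (Fm → Fm) → ℕ → Fm
bwWith M n =
  ⋀ (map (λ i → M (p i)) (idx n)) ⇒
  ⋁ (concatMap (λ i → map (λ j → M (p i ∧' (p j ∨' M (p j))))
                          (filter (λ j → ¬? (i ≟ j)) (idx n)))
               (idx n))

bw⁺ : ℕ → Fm
bw⁺ = bwWith ◇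

bw⁻ : ℕ → Fm
bw⁻ = bwWith 𝐏

-- bd_k for k ≥ 1 (bd 0 is an unused dummy)
bd : ℕ → Fm
bd zero          = ⊤'
bd (suc zero)    = ◇ (□ (p 0)) ⇒ p 0
bd (suc (suc j)) = ◇ (□ (p (suc j)) ∧' ~ bd (suc j)) ⇒ p (suc j)

data S4BPAx (k : ℕ) (l : Maybe ℕ) (n m : ℕ) : Fm → Set where
  T    : S4BPAx k l n m (□ (p 0) ⇒ p 0)
  Four : S4BPAx k l n m (□ (p 0) ⇒ □ (□ (p 0)))
  BD   : S4BPAx k l n m (bd k)
  BZ   : S4BPAx k l n m (bz l)
  BW⁺  : S4BPAx k l n m (bw⁺ n)
  BW⁻  : S4BPAx k l n m (bw⁻ m)

record Frame : Set₁ where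
  field
    W : Set
    R : W → W → Set

open Frame public

Valuation : Frame → Set₁
Valuation F = ℕ → W F → Set

⟦_⟧ : Fm → (F : Frame) → Valuation F → W F → Set
⟦ var i ⟧ F V w = V i w
⟦ ⊥' ⟧    F V w = Empty
⟦ A ⇒ B ⟧ F V w = ⟦ A ⟧ F V w → ⟦ B ⟧ F V w
⟦ □ A ⟧   F V w = ∀ v → R F w v → ⟦ A ⟧ F V v
⟦ ■ A ⟧   F V w = ∀ v → R F v w → ⟦ A ⟧ F V v

_⊨_ : Frame → Fm → Set₁
F ⊨ A = ∀ (V : Valuation F) (w : W F) → ⟦ A ⟧ F V w

LogicOf : (Frame → Set₁) → Fm → Set₁
LogicOf C A = ∀ F → C F → F ⊨ A

IsLogicOf : (Fm → Set) → (Frame → Set₁) → Set₁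
IsLogicOf L C = ∀ A → (L A → LogicOf C A) × (LogicOf C A → L A)

FiniteFrame : Frame → Set
FiniteFrame F = Σ ℕ (λ N → W F ↔ Fin N)

KripkeComplete : (Fm → Set) → Set₂
KripkeComplete L = Σ (Frame → Set₁) (λ C → IsLogicOf L C)

FMP : (Fm → Set) → Set₂
FMP L = Σ (Frame → Set₁) (λ C → (∀ F → C F → FiniteFrame F) × IsLogicOf L C)

{-# OPTIONS --safe #-}
module Submission where

-- A non-theorem A of L is refuted in the canonical model of the set of formulas that L proves
-- after the variables not in A are replaced by ⊥'.  There bw⁺, bw⁻ and bd bound the width (in
-- both directions) and the depth, and the points of a cluster are told apart by the finitely many
-- variables of A, so every point has only finitely many successors and predecessors.  The truth
-- of a formula at a point then depends on the valuation at finitely many points only, where any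
-- valuation is definable by formulas; hence the frame of the connected component of a refuting
-- point validates L.  If bz_l is in L, this component is exhausted by l steps from any point,
-- hence finite.

open import Defs
open import Level using (0ℓ)
open import Axiom.ExcludedMiddle using (ExcludedMiddle)
open import Data.Bool using (Bool) renaming (T to IsTrue)
open import Data.Nat using (ℕ; zero; suc; _+_; _⊔_; _≤_; _<_; _≤′_; ≤′-refl; ≤′-step; z≤n; s≤s; s<s⁻¹; _≟_)
open import Data.Nat.Properties
  using (≤-refl; <⇒≢; <-cmp; ≤⇒≤′; z≤′n; m≤n⇒m≤1+n; m≤m⊔n; m≤n⊔m; +-suc; +-identityʳ)
open import Data.Fin using (Fin; zero; suc)
open import Data.Maybe using (Maybe; just; nothing)
open import Data.List
  using (List; []; _∷_; _++_; length; lookup; map; concatMap; filter; foldl; cartesianProductWith; allFin)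
open import Data.List.Membership.Propositional using (_∈_; _∉_; find; lose)
open import Data.List.Membership.Propositional.Properties
open import Data.List.Membership.DecPropositional _≟_ using (_∈?_)
open import Data.List.Relation.Unary.Any using (Any; here; there)
import Data.List.Relation.Unary.Any as Any
import Data.List.Relation.Unary.Any.Properties as Any
open import Data.List.Relation.Unary.All using (All; []; _∷_)
import Data.List.Relation.Unary.All as All
import Data.List.Relation.Unary.All.Properties as All
open import Data.List.Relation.Unary.AllPairs using (AllPairs; []; _∷_)
import Data.List.Relation.Unary.AllPairs.Properties as AllPairs
open import Data.Product using (Σ; _×_; _,_; proj₁; proj₂)
open import Data.Sum using (_⊎_; inj₁; inj₂; [_,_]′)
open import Data.Empty using (⊥-elim)
open import Function using (_∘_; id; flip)
open import Function.Construct.Identity using (↔-id)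
open import Relation.Binary.Definitions using (tri<; tri≈; tri>)
open import Relation.Nullary using (Dec; yes; no; ¬_; ¬?)
open import Relation.Nullary.Decidable using (isYes; toWitness; fromWitness; decidable-stable)
open import Relation.Binary.PropositionalEquality
  using (_≡_; _≢_; refl; trans; sym; cong; cong₂) renaming (subst to ≡-subst)

-- The two directions of time, treated uniformly

data Dir : Set where
  fwd bwd : Dir

op : Dir → Dir
op fwd = bwd
op bwd = fwd

bx : Dir → Fm → Fm
bx fwd = □
bx bwd = ■

dia : Dir → Fm → Fm
dia d A = ~ bx d (~ A)

rel : (F : Frame) → Dir → W F → W F → Set
rel F fwd x y = R F x y
rel F bwd x y = R F y x

-- Exhaustion of the formulas by finite lists

implications : List Fm → List Fm
implications As = cartesianProductWith _⇒_ As As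

-- Cumulative finite lists take the place of a numbering of the formulas, so that a theory can be
-- completed in stages.
formulas : ℕ → List Fm
formulas zero = []
formulas (suc d) =
  ⊥' ∷ var d ∷ implications (formulas d)
    ++ map □ (formulas d) ++ map ■ (formulas d) ++ formulas d

formulas-mono : ∀ {A d e} → d ≤′ e → A ∈ formulas d → A ∈ formulas e
formulas-mono ≤′-refl a = a
formulas-mono {e = suc e} (≤′-step d≤e) a =
  there (there (∈-++⁺ʳ (implications (formulas e)) (∈-++⁺ʳ (map □ (formulas e)) (∈-++⁺ʳ (map ■ (formulas e)) (formulas-mono d≤e a)))))

formulas-complete : ∀ A → Σ ℕ λ d → A ∈ formulas d
formulas-complete (var i) = suc i , there (here refl)
formulas-complete ⊥' = 1 , here refl
formulas-complete (A ⇒ B) with formulas-complete A | formulas-complete B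
... | d , a | e , b = suc (d ⊔ e) , there (there (∈-++⁺ˡ (∈-cartesianProductWith⁺ _⇒_
        (formulas-mono (≤⇒≤′ (m≤m⊔n d e)) a) (formulas-mono (≤⇒≤′ (m≤n⊔m d e)) b))))
formulas-complete (□ A) with formulas-complete A
... | d , a = suc d , there (there (∈-++⁺ʳ (implications (formulas d)) (∈-++⁺ˡ (∈-map⁺ □ a))))
formulas-complete (■ A) with formulas-complete A
... | d , a = suc d , there (there (∈-++⁺ʳ (implications (formulas d)) (∈-++⁺ʳ (map □ (formulas d)) (∈-++⁺ˡ (∈-map⁺ ■ a)))))

-- The canonical model and its truth lemma

module Canonical
  (em : ExcludedMiddle 0ℓ)
  (Λ : Fm → Set)
  (Λ-ax : ∀ {A} → KtAx A → Λ A)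
  (Λ-mp : ∀ {A B} → Λ (A ⇒ B) → Λ A → Λ B)
  (Λ-nec : ∀ d {A} → Λ A → Λ (bx d A))
  where

  record Theory : Set₁ where
    field
      holds : Fm → Set
      thm   : ∀ {A} → Λ A → holds A
      app    : ∀ {A B} → holds (A ⇒ B) → holds A → holds B
  open Theory

  theorems : Theory
  theorems = record { holds = Λ ; thm = id ; app = Λ-mp }

  -- The deduction theorem holds by construction: B is in 𝕋 ▷ A when A ⇒ B is in 𝕋.
  _▷_ : Theory → Fm → Theory
  𝕋 ▷ A = record
    { holds = λ B → holds 𝕋 (A ⇒ B)
    ; thm   = λ b → app 𝕋 (thm 𝕋 (Λ-ax (ax-K _ _))) (thm 𝕋 b)
    ; app    = λ f b → app 𝕋 (app 𝕋 (thm 𝕋 (Λ-ax (ax-S _ _ _))) f) b }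

  ▷-weaken : ∀ 𝕋 {A B} → holds 𝕋 B → holds (𝕋 ▷ A) B
  ▷-weaken 𝕋 b = app 𝕋 (thm 𝕋 (Λ-ax (ax-K _ _))) b

  Λ-id : ∀ {A} → Λ (A ⇒ A)
  Λ-id {A} = Λ-mp (Λ-mp (Λ-ax (ax-S A (A ⇒ A) A)) (Λ-ax (ax-K _ _))) (Λ-ax (ax-K _ _))

  ▷-new : ∀ 𝕋 {A} → holds (𝕋 ▷ A) A
  ▷-new 𝕋 = thm 𝕋 Λ-id

  Λ-dni : ∀ {A} → Λ (A ⇒ ~ ~ A)
  Λ-dni {A} = app 𝕋 (▷-new (theorems ▷ A)) (▷-weaken (theorems ▷ A) {~ A} (▷-new theorems))
    where 𝕋 = (theorems ▷ A) ▷ (~ A)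

  Λ-exfalso : ∀ {A B} → Λ (~ A ⇒ (A ⇒ B))
  Λ-exfalso {A} {B} = app 𝕋 (thm 𝕋 (Λ-ax (ax-DN B)))
      (▷-weaken 𝕋 {~ B} (app 𝕋 (▷-weaken (theorems ▷ (~ A)) (▷-new theorems)) (▷-new (theorems ▷ (~ A)))))
    where 𝕋 = (theorems ▷ (~ A)) ▷ A

  Consistent : Theory → Set
  Consistent 𝕋 = ¬ holds 𝕋 ⊥'

  _⊆_ : Theory → Theory → Set
  𝕋 ⊆ 𝕌 = ∀ {A} → holds 𝕋 A → holds 𝕌 A

  pick : ∀ 𝕋 A → Dec (Consistent (𝕋 ▷ A)) → Theory
  pick 𝕋 A (yes _) = 𝕋 ▷ A
  pick 𝕋 A (no _)  = 𝕋

  step : Theory → Fm → Theory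
  step 𝕋 A = pick 𝕋 A em

  step-⊆ : ∀ 𝕋 A → 𝕋 ⊆ step 𝕋 A
  step-⊆ 𝕋 A with em {Consistent (𝕋 ▷ A)}
  ... | yes _ = ▷-weaken 𝕋
  ... | no _  = id

  step-consistent : ∀ 𝕋 A → Consistent 𝕋 → Consistent (step 𝕋 A)
  step-consistent 𝕋 A c with em {Consistent (𝕋 ▷ A)}
  ... | yes c′ = c′
  ... | no _   = c

  -- If adding `A` is inconsistent, then `𝕋` already contains `A ⇒ ⊥'`, which is `~ A` itself.
  step-decides : ∀ 𝕋 A → holds (step 𝕋 A) A ⊎ holds (step 𝕋 A) (~ A)
  step-decides 𝕋 A with em {Consistent (𝕋 ▷ A)}
  ... | yes _ = inj₁ (▷-new 𝕋)
  ... | no ¬c = inj₂ (decidable-stable em ¬c)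

  steps : Theory → List Fm → Theory
  steps = foldl step

  steps-⊆ : ∀ 𝕋 As → 𝕋 ⊆ steps 𝕋 As
  steps-⊆ 𝕋 []       = id
  steps-⊆ 𝕋 (A ∷ As) = steps-⊆ (step 𝕋 A) As ∘ step-⊆ 𝕋 A

  steps-consistent : ∀ 𝕋 As → Consistent 𝕋 → Consistent (steps 𝕋 As)
  steps-consistent 𝕋 []       c = c
  steps-consistent 𝕋 (A ∷ As) c = steps-consistent (step 𝕋 A) As (step-consistent 𝕋 A c)

  steps-decides : ∀ 𝕋 {A As} → A ∈ As → holds (steps 𝕋 As) A ⊎ holds (steps 𝕋 As) (~ A)
  steps-decides 𝕋 {A} {_ ∷ As} (here refl) with step-decides 𝕋 A
  ... | inj₁ a  = inj₁ (steps-⊆ (step 𝕋 A) As a)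
  ... | inj₂ ¬a = inj₂ (steps-⊆ (step 𝕋 A) As ¬a)
  steps-decides 𝕋 {As = B ∷ _} (there a) = steps-decides (step 𝕋 B) a

  stage : Theory → ℕ → Theory
  stage 𝕋 zero    = 𝕋
  stage 𝕋 (suc d) = steps (stage 𝕋 d) (formulas d)

  stage-mono : ∀ 𝕋 {d e} → d ≤′ e → stage 𝕋 d ⊆ stage 𝕋 e
  stage-mono 𝕋 ≤′-refl = id
  stage-mono 𝕋 {e = suc e} (≤′-step d≤e) = steps-⊆ (stage 𝕋 e) (formulas e) ∘ stage-mono 𝕋 d≤e

  stage-consistent : ∀ 𝕋 d → Consistent 𝕋 → Consistent (stage 𝕋 d)
  stage-consistent 𝕋 zero    c = c
  stage-consistent 𝕋 (suc d) c = steps-consistent (stage 𝕋 d) (formulas d) (stage-consistent 𝕋 d c)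

  limit : Theory → Theory
  limit 𝕋 = record
    { holds = λ A → Σ ℕ λ d → holds (stage 𝕋 d) A
    ; thm   = λ a → 0 , thm 𝕋 a
    ; app    = λ { (d , f) (e , a) → d ⊔ e ,
                app (stage 𝕋 (d ⊔ e)) (stage-mono 𝕋 (≤⇒≤′ (m≤m⊔n d e)) f)
                                     (stage-mono 𝕋 (≤⇒≤′ (m≤n⊔m d e)) a) } }

  limit-decides : ∀ 𝕋 A → holds (limit 𝕋) A ⊎ holds (limit 𝕋) (~ A)
  limit-decides 𝕋 A with formulas-complete A
  ... | d , a with steps-decides (stage 𝕋 d) a
  ...   | inj₁ h = inj₁ (suc d , h)
  ...   | inj₂ h = inj₂ (suc d , h)

  -- Membership is Bool-valued because the worlds of a frame form a small type.
  record World : Set where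
    field
      mem : Fm → Bool

    infix 4 ∋_
    ∋_ : Fm → Set
    ∋ A = IsTrue (mem A)

    field
      ∋-thm  : ∀ {A} → Λ A → ∋ A
      ∋-app   : ∀ {A B} → ∋ A ⇒ B → ∋ A → ∋ B
      ∌⊥     : ¬ ∋ ⊥'
      ∋-neg  : ∀ {A} → ¬ ∋ A → ∋ ~ A
  open World

  infix 4 _∋_
  _∋_ : World → Fm → Set
  x ∋ A = ∋_ x A

  lindenbaum : ∀ 𝕋 → Consistent 𝕋 → Σ World λ x → ∀ {A} → holds 𝕋 A → x ∋ A
  lindenbaum 𝕋 c = x , λ a → fromWitness (0 , a)
    where
    x : World
    x = record
      { mem   = λ A → isYes (em {holds (limit 𝕋) A})
      ; ∋-thm = λ a → fromWitness (thm (limit 𝕋) a)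
      ; ∋-app  = λ f a → fromWitness (app (limit 𝕋) (toWitness f) (toWitness a))
      ; ∌⊥    = λ b → stage-consistent 𝕋 (proj₁ (toWitness b)) c (proj₂ (toWitness b))
      ; ∋-neg = λ {A} ¬a → [ (λ a → ⊥-elim (¬a (fromWitness a))) , fromWitness ]′ (limit-decides 𝕋 A) }

  Λ-K : ∀ d A B → Λ (bx d (A ⇒ B) ⇒ (bx d A ⇒ bx d B))
  Λ-K fwd A B = Λ-ax (ax-K□ A B)
  Λ-K bwd A B = Λ-ax (ax-K■ A B)

  Λ-conv : ∀ d A → Λ (A ⇒ bx d (dia (op d) A))
  Λ-conv fwd A = Λ-ax (ax-conv□ A)
  Λ-conv bwd A = Λ-ax (ax-conv■ A)

  bx-mp : ∀ d x {A B} → x ∋ bx d (A ⇒ B) → x ∋ bx d A → x ∋ bx d B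
  bx-mp d x f a = ∋-app x (∋-app x (∋-thm x (Λ-K d _ _)) f) a

  bx-map : ∀ d x {A B} → Λ (A ⇒ B) → x ∋ bx d A → x ∋ bx d B
  bx-map d x f = bx-mp d x (∋-thm x (Λ-nec d f))

  Acc : Dir → World → World → Set
  Acc d x y = ∀ A → x ∋ bx d A → y ∋ A

  -- Were `~ A` in `x`, the conversion axiom would put `dia (op d) (~ A)` into `y`, against
  -- `bx (op d) A`. Hence one relation interprets both `□` and `■`.
  acc-op : ∀ d x y → Acc d x y → Acc (op d) y x
  acc-op d x y r A a = decidable-stable em λ ¬a →
    ∌⊥ y (∋-app y (r _ (∋-app x (∋-thm x (Λ-conv d (~ A))) (∋-neg x ¬a))) (bx-map (op d) y Λ-dni a))

  -- The witness extends the theory of all `B` with `bx d (~ A ⇒ B)` in `x`. It is consistent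
  -- because `~ A ⇒ ⊥'` is the double negation of `A`.
  existence : ∀ d x A → ¬ x ∋ bx d A → Σ World λ y → Acc d x y × ¬ y ∋ A
  existence d x A ¬□A with lindenbaum 𝕋 (λ a → ¬□A (bx-map d x (Λ-ax (ax-DN A)) a))
    where
    𝕋 : Theory
    𝕋 = record
      { holds = λ B → x ∋ bx d (~ A ⇒ B)
      ; thm   = λ b → ∋-thm x (Λ-nec d (Λ-mp (Λ-ax (ax-K _ _)) b))
      ; app    = λ f b → bx-mp d x (bx-map d x (Λ-ax (ax-S _ _ _)) f) b }
  ... | y , h = y , (λ B b → h (bx-map d x (Λ-ax (ax-K _ _)) b)) ,
                λ a → ∌⊥ y (∋-app y (h (∋-thm x (Λ-nec d Λ-id))) a)

  canonicalFrame : Frame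
  canonicalFrame = record { W = World ; R = Acc fwd }

  canonicalValuation : Valuation canonicalFrame
  canonicalValuation i x = x ∋ var i

  truth⁺ : ∀ A x → ⟦ A ⟧ canonicalFrame canonicalValuation x → x ∋ A
  truth⁻ : ∀ A x → x ∋ A → ⟦ A ⟧ canonicalFrame canonicalValuation x

  truth⁺ (var i) x a = a
  truth⁺ (A ⇒ B) x f with em {x ∋ A}
  ... | yes a = ∋-app x (∋-thm x (Λ-ax (ax-K _ _))) (truth⁺ B x (f (truth⁻ A x a)))
  ... | no ¬a = ∋-app x (∋-thm x Λ-exfalso) (∋-neg x ¬a)
  truth⁺ (□ A) x f = decidable-stable em λ ¬□A → let (y , r , ¬a) = existence fwd x A ¬□A in
    ¬a (truth⁺ A y (f y r))
  truth⁺ (■ A) x f = decidable-stable em λ ¬■A → let (y , r , ¬a) = existence bwd x A ¬■A in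
    ¬a (truth⁺ A y (f y (acc-op bwd x y r)))

  truth⁻ (var i) x a = a
  truth⁻ ⊥' x b = ∌⊥ x b
  truth⁻ (A ⇒ B) x f a = truth⁻ B x (∋-app x f (truth⁺ A x a))
  truth⁻ (□ A) x f y r = truth⁻ A y (r A f)
  truth⁻ (■ A) x f y r = truth⁻ A y (acc-op fwd y x r A f)

-- Chains, and finiteness up to a relation

Strict : {X : Set} → (X → X → Set) → X → X → Set
Strict _≼_ x y = x ≼ y × ¬ y ≼ x

Incomparable : {X : Set} → (X → X → Set) → X → X → Set
Incomparable _≼_ x y = ¬ x ≼ y × ¬ y ≼ x

data Chain {X : Set} (_≼_ : X → X → Set) : ℕ → X → Set where
  []  : ∀ {x} → Chain _≼_ 0 x
  _∷_ : ∀ {j x y} → Strict _≼_ x y → Chain _≼_ j y → Chain _≼_ (suc j) x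

-- The links move one by one onto an accumulator, as in list reversal. This transfers a bound on
-- ascending chains to descending ones.
reverse-chain : {X : Set} {_≼_ : X → X → Set} → ∀ {i j x} →
  Chain (flip _≼_) i x → Chain _≼_ j x → Σ X (Chain _≼_ (i + j))
reverse-chain [] d = _ , d
reverse-chain {_≼_ = _≼_} {suc i} {j} (lt ∷ c) d =
  let (y , e) = reverse-chain c (lt ∷ d) in y , ≡-subst (λ h → Chain _≼_ h y) (+-suc i j) e

-- The representatives have to satisfy `P`, so that a relation can be refined using facts valid
-- inside `P` only, and so that listed neighbours really are neighbours.
FinitelyCovered : {X : Set} → (X → X → Set) → (X → Set) → Set
FinitelyCovered {X} _≈_ P = Σ (List X) λ ys → All P ys × (∀ y → P y → Any (y ≈_) ys)

covered-∪ : {X : Set} {_≈_ : X → X → Set} {P Q S : X → Set} →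
  (∀ {y} → P y → S y) → (∀ {y} → Q y → S y) → (∀ y → S y → Dec (P y)) → (∀ y → S y → ¬ P y → Q y) →
  FinitelyCovered _≈_ P → FinitelyCovered _≈_ Q → FinitelyCovered _≈_ S
covered-∪ P⊆S Q⊆S P? split (ys , ps , cp) (zs , qs , cq) =
  ys ++ zs , All.++⁺ (All.map P⊆S ps) (All.map Q⊆S qs) , cover
  where
  cover : ∀ y → _ → _
  cover y s with P? y s
  ... | yes py = Any.++⁺ˡ (cp y py)
  ... | no ¬py = Any.++⁺ʳ ys (cq y (split y s ¬py))

covered-refine : {X : Set} {_∼_ _≈_ : X → X → Set} {P : X → Set} →
  (∀ {y z} → P y → P z → y ∼ z → y ≈ z) → FinitelyCovered _∼_ P → FinitelyCovered _≈_ P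
covered-refine {X} {_∼_} {_≈_} {P} ∼⇒≈ (zs , ps , cover) = zs , ps , λ y py → go py ps (cover y py)
  where
  go : ∀ {y zs} → P y → All P zs → Any (y ∼_) zs → Any (y ≈_) zs
  go py (pz ∷ _)  (here y∼z) = here (∼⇒≈ py pz y∼z)
  go py (_ ∷ pzs) (there any) = there (go py pzs any)

-- Finite upsets in preorders of bounded depth and width

module FiniteUpsets
  (em : ExcludedMiddle 0ℓ)
  {X : Set} (_≼_ _≈_ : X → X → Set)
  (≼-refl : ∀ {x} → x ≼ x)
  (≼-trans : ∀ {x y z} → x ≼ y → y ≼ z → x ≼ z)
  (k : ℕ) (no-chain : ∀ {x} → ¬ Chain _≼_ k x)
  (N : ℕ) (no-antichain : ∀ x ys → length ys ≡ N → All (x ≼_) ys → ¬ AllPairs (Incomparable _≼_) ys)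
  (finite-clusters : ∀ x → FinitelyCovered _≈_ (λ y → x ≼ y × y ≼ x))
  where

  Cover : X → X → Set
  Cover x y = Strict _≼_ x y × ∀ z → Strict _≼_ x z → z ≼ y → y ≼ z

  -- As long as some `z` lies strictly between `x` and `y`, it replaces `y`, and the chain running
  -- upwards from `y` gains a link. At `k` links this is impossible.
  cover-below : ∀ {x y} → Strict _≼_ x y → Σ X λ c → Cover x c × c ≼ y
  cover-below x≺y = descend k 0 (+-identityʳ k) x≺y []
    where
    descend : ∀ {x y} fuel j → fuel + j ≡ k → Strict _≼_ x y → Chain _≼_ j y → Σ X λ c → Cover x c × c ≼ y
    descend {x} {y} fuel j eq x≺y c with em {Σ X λ z → Strict _≼_ x z × Strict _≼_ z y}
    descend {x} {y} fuel j eq (x≼y , y⋠x) c | no ¬z =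
      y , ((x≼y , y⋠x) , λ z x≺z z≼y → decidable-stable em λ y⋠z → ¬z (z , x≺z , z≼y , y⋠z)) , ≼-refl
    descend zero j refl x≺y c | yes (z , x≺z , z≺y) = ⊥-elim (no-chain c)
    descend (suc fuel) j eq x≺y c | yes (z , x≺z , z≺y)
      with descend fuel (suc j) (trans (+-suc fuel j) eq) x≺z (z≺y ∷ c)
    ... | m , cov , m≼z = m , cov , ≼-trans m≼z (proj₁ z≺y)

  -- Covers are collected greedily, each new one above none of the earlier. By minimality of the
  -- earlier ones it is not below them either, so the list stays an antichain and cannot reach
  -- length `N`.
  covers : ∀ x → Σ (List X) λ cs → All (Cover x) cs × ∀ y → Cover x y → Any (_≼ y) cs
  covers x = grow N [] [] [] (+-identityʳ N)
    where
    grow : ∀ fuel cs → All (Cover x) cs → AllPairs (Incomparable _≼_) cs → fuel + length cs ≡ N →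
           Σ (List X) λ cs → All (Cover x) cs × ∀ y → Cover x y → Any (_≼ y) cs
    grow fuel cs covs inc eq with em {Σ X λ y → Cover x y × ¬ Any (_≼ y) cs}
    grow fuel cs covs inc eq | no ¬y =
      cs , covs , λ y cov → decidable-stable em λ ¬any → ¬y (y , cov , ¬any)
    grow zero cs covs inc eq | yes _ =
      ⊥-elim (no-antichain x cs eq (All.map (proj₁ ∘ proj₁) covs) inc)
    grow (suc fuel) cs covs inc eq | yes (y , cov , ¬any) =
      grow fuel (y ∷ cs) (cov ∷ covs)
        (All.zipWith (λ { (c⋠y , (x≺c , min)) → (λ y≼c → c⋠y (min y (proj₁ cov) y≼c)) , c⋠y })
          (All.¬Any⇒All¬ cs ¬any , covs) ∷ inc)
        (trans (+-suc fuel (length cs)) eq)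

  -- The upset of `x` is its cluster together with the upsets of finitely many covers. The recursion
  -- is on a strict bound for the chains from `x`, which drops by one at each cover.
  upset-finite : ∀ x → FinitelyCovered _≈_ (x ≼_)
  upset-finite x = go k x no-chain
    where
    ups : ∀ {x} cs → All (λ c → x ≼ c × FinitelyCovered _≈_ (c ≼_)) cs →
          FinitelyCovered _≈_ (λ y → x ≼ y × Any (_≼ y) cs)
    ups [] [] = [] , [] , λ { y (_ , ()) }
    ups (c ∷ cs) ((x≼c , fin) ∷ fins) = covered-∪
      (λ c≼y → ≼-trans x≼c c≼y , here c≼y) (λ (x≼y , any) → x≼y , there any) (λ _ _ → em)
      (λ { y (x≼y , here c≼y) c⋠y → ⊥-elim (c⋠y c≼y) ; y (x≼y , there any) _ → x≼y , any })
      fin (ups cs fins)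

    go : ∀ f x → ¬ Chain _≼_ f x → FinitelyCovered _≈_ (x ≼_)
    go zero x ¬c = ⊥-elim (¬c [])
    go (suc f) x ¬c with covers x
    ... | cs , covs , complete = covered-∪ proj₁ proj₁ (λ _ _ → em)
      (λ y x≼y ¬cl → x≼y ,
        let (c , cov , c≼y) = cover-below (x≼y , λ y≼x → ¬cl (x≼y , y≼x))
        in Any.map (λ d≼c → ≼-trans d≼c c≼y) (complete c cov))
      (finite-clusters x)
      (ups cs (All.map (λ ((x≼c , c⋠x) , _) → x≼c , go f _ λ ch → ¬c ((x≼c , c⋠x) ∷ ch)) covs))

-- Positions are natural numbers, like the variables in `bwWith`, so that every variable gets a
-- world; the default `x` is never reached below the length.
nth : {X : Set} → X → List X → ℕ → X
nth x []       i       = x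
nth x (y ∷ ys) zero    = y
nth x (y ∷ ys) (suc i) = nth x ys i

nth-All : ∀ {X : Set} {P : X → Set} {x ys i} → All P ys → i < length ys → P (nth x ys i)
nth-All {i = zero}  (p ∷ _)  _   = p
nth-All {i = suc i} (_ ∷ ps) i<n = nth-All ps (s<s⁻¹ i<n)

nth-AllPairs : ∀ {X : Set} {P : X → X → Set} → (∀ {x y} → P x y → P y x) →
  ∀ {x ys i j} → AllPairs P ys → i ≢ j → i < length ys → j < length ys → P (nth x ys i) (nth x ys j)
nth-AllPairs P-sym {i = zero}  {zero}  _        i≢j _   _   = ⊥-elim (i≢j refl)
nth-AllPairs P-sym {i = zero}  {suc j} (p ∷ _)  _   _   j<n = nth-All p (s<s⁻¹ j<n)
nth-AllPairs P-sym {i = suc i} {zero}  (p ∷ _)  _   i<n _   = P-sym (nth-All p (s<s⁻¹ i<n))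
nth-AllPairs P-sym {i = suc i} {suc j} (_ ∷ ps) i≢j i<n j<n =
  nth-AllPairs P-sym ps (i≢j ∘ cong suc) (s<s⁻¹ i<n) (s<s⁻¹ j<n)

-- Classical forcing in a frame

module Forcing (em : ExcludedMiddle 0ℓ) (F : Frame) where

  infix 4 _,_⊩_
  _,_⊩_ : Valuation F → W F → Fm → Set
  V , x ⊩ A = ⟦ A ⟧ F V x

  bx⁺ : ∀ d {V x A} → (∀ y → rel F d x y → V , y ⊩ A) → V , x ⊩ bx d A
  bx⁺ fwd f = f
  bx⁺ bwd f = f

  bx⁻ : ∀ d {V x A} → V , x ⊩ bx d A → ∀ y → rel F d x y → V , y ⊩ A
  bx⁻ fwd f = f
  bx⁻ bwd f = f

  dia⁺ : ∀ d {V x} A y → rel F d x y → V , y ⊩ A → V , x ⊩ dia d A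
  dia⁺ d A y r a □¬a = bx⁻ d □¬a y r a

  dia⁻ : ∀ d {V x A} → V , x ⊩ dia d A → Σ (W F) λ y → rel F d x y × V , y ⊩ A
  dia⁻ d h = decidable-stable em λ ¬y → h (bx⁺ d λ y r a → ¬y (y , r , a))

  ∧⁻ : ∀ {V x} A B → V , x ⊩ A ∧' B → V , x ⊩ A × V , x ⊩ B
  ∧⁻ A B h = decidable-stable em (λ ¬a → h λ a _ → ¬a a) , decidable-stable em (λ ¬b → h λ _ b → ¬b b)

  ∨⁻ : ∀ {V x} A B → V , x ⊩ A ∨' B → V , x ⊩ A ⊎ V , x ⊩ B
  ∨⁻ {V} {x} A B h with em {V , x ⊩ A}
  ... | yes a = inj₁ a
  ... | no ¬a = inj₂ (h ¬a)

  ⋀⁺ : ∀ {V x} As → All (V , x ⊩_) As → V , x ⊩ ⋀ As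
  ⋀⁺ [] [] = id
  ⋀⁺ (A ∷ []) (a ∷ []) = a
  ⋀⁺ (A ∷ As@(_ ∷ _)) (a ∷ as) = λ f → f a (⋀⁺ As as)

  ⋀⁻ : ∀ {V x} As → V , x ⊩ ⋀ As → All (V , x ⊩_) As
  ⋀⁻ [] _ = []
  ⋀⁻ (A ∷ []) a = a ∷ []
  ⋀⁻ (A ∷ As@(_ ∷ _)) h = let (a , as) = ∧⁻ A (⋀ As) h in a ∷ ⋀⁻ As as

  ⋁⁻ : ∀ {V x} As → V , x ⊩ ⋁ As → Any (V , x ⊩_) As
  ⋁⁻ (A ∷ []) a = here a
  ⋁⁻ (A ∷ As@(_ ∷ _)) h = [ here , there ∘ ⋁⁻ As ]′ (∨⁻ A (⋁ As) h)

  substitution⁺ : ∀ {V σ} A {x} → V , x ⊩ A [ σ ] → (λ i y → V , y ⊩ σ i) , x ⊩ A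
  substitution⁻ : ∀ {V σ} A {x} → (λ i y → V , y ⊩ σ i) , x ⊩ A → V , x ⊩ A [ σ ]
  substitution⁺ (var i) a = a
  substitution⁺ (A ⇒ B) f a = substitution⁺ B (f (substitution⁻ A a))
  substitution⁺ (□ A) f y r = substitution⁺ A (f y r)
  substitution⁺ (■ A) f y r = substitution⁺ A (f y r)
  substitution⁻ (var i) a = a
  substitution⁻ (A ⇒ B) f a = substitution⁻ B (f (substitution⁺ A a))
  substitution⁻ (□ A) f y r = substitution⁻ A (f y r)
  substitution⁻ (■ A) f y r = substitution⁻ A (f y r)

-- Models of the axioms in which boxed formulas determine accessibility

module TightModel
  (em : ExcludedMiddle 0ℓ)
  {k n m : ℕ} {l : Maybe ℕ} {L : Fm → Set}
  (N : NormalTenseLogic L) (axiom : ∀ {A} → S4BPAx (suc k) l n m A → L A)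
  (F : Frame) (V : Valuation F)
  (sound : ∀ {A} → L A → ∀ x → ⟦ A ⟧ F V x)
  (tight : ∀ {x y} → (∀ A → ⟦ □ A ⟧ F V x → ⟦ A ⟧ F V y) → R F x y)
  (vs : List ℕ) (vs-only : ∀ {i} → i ∉ vs → ∀ x → ¬ V i x)
  where

  open Forcing em F

  infix 4 _⊩_ _≈_
  _⊩_ : W F → Fm → Set
  x ⊩ A = ⟦ A ⟧ F V x

  _≈_ : W F → W F → Set
  x ≈ y = ∀ A → (x ⊩ A → y ⊩ A) × (y ⊩ A → x ⊩ A)

  ≈-sym : ∀ {x y} → x ≈ y → y ≈ x
  ≈-sym x≈y A = let (f , g) = x≈y A in g , f

  ≈-trans : ∀ {x y z} → x ≈ y → y ≈ z → x ≈ z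
  ≈-trans x≈y y≈z A = let (f , g) = x≈y A ; (f′ , g′) = y≈z A in f′ ∘ f , g ∘ g′

  instance-of : ∀ {A} → L A → ∀ σ x → x ⊩ A [ σ ]
  instance-of {A} a σ = sound (NormalTenseLogic.subst N A σ a)

  R-refl : ∀ {x} → R F x x
  R-refl {x} = tight λ A → instance-of (axiom T) (λ _ → A) x

  R-trans : ∀ {x y z} → R F x y → R F y z → R F x z
  R-trans {x} {y} {z} xRy yRz = tight λ A □a → instance-of (axiom Four) (λ _ → A) x □a y xRy z yRz

  rel-refl : ∀ d {x} → rel F d x x
  rel-refl fwd = R-refl
  rel-refl bwd = R-refl

  rel-trans : ∀ d {x y z} → rel F d x y → rel F d y z → rel F d x z
  rel-trans fwd xRy yRz = R-trans xRy yRz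
  rel-trans bwd yRx zRy = R-trans zRy yRx

  -- For `bwd`: if `A` fails at `x`, then `■ (◇ (~ A))` holds at `x`, so `◇ (~ A)` holds at `y`,
  -- which excludes `□ A` there.
  rel-tight : ∀ d {x y} → (∀ A → x ⊩ bx d A → y ⊩ A) → rel F d x y
  rel-tight fwd h = tight h
  rel-tight bwd {x} {y} h = tight λ A □a → decidable-stable em λ ¬a →
    h (◇ (~ A)) (λ z zRx □¬¬a → □¬¬a x zRx ¬a) λ z yRz ¬a′ → ¬a′ (□a z yRz)

  ≈-rel : ∀ d {x x′ y} → x ≈ x′ → rel F d x y → rel F d x′ y
  ≈-rel d x≈x′ r = rel-tight d λ A □a → bx⁻ d (proj₂ (x≈x′ (bx d A)) □a) _ r

  -- A formula is returned for every pair, with `⊥'` as default for related points, so that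
  -- substitutions can be built from separators before it is known which pairs are unrelated.
  separator : ∀ d x y → Σ Fm λ A → ¬ rel F d x y → x ⊩ bx d A × ¬ y ⊩ A
  separator d x y with em {Σ Fm λ A → x ⊩ bx d A × ¬ y ⊩ A}
  ... | yes (A , h) = A , λ _ → h
  ... | no ¬h = ⊥' , λ ¬r → ⊥-elim (¬r (rel-tight d λ A □a → decidable-stable em λ ¬a → ¬h (A , □a , ¬a)))

  distinguish : ∀ {x y} → ¬ x ≈ y → Σ Fm λ A → x ⊩ A × ¬ y ⊩ A
  distinguish {x} {y} x≉y = decidable-stable em λ ¬A →
    let f = λ A x⊩A → decidable-stable em λ y⊮A → ¬A (A , x⊩A , y⊮A) in
    -- A formula true only at `y` is replaced by its negation.
    x≉y λ A → f A , λ y⊩A → decidable-stable em λ x⊮A → f (~ A) x⊮A y⊩A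

  separate : ∀ x ys → ¬ Any (x ≈_) ys → Σ Fm λ A → x ⊩ A × All (λ y → ¬ y ⊩ A) ys
  separate x [] _ = ⊤' , id , []
  separate x (y ∷ ys) ¬any with distinguish (¬any ∘ here) | separate x ys (¬any ∘ there)
  ... | A , a , ¬a | B , b , ¬bs = A ∧' B , (λ f → f a b) ,
    (λ h → h λ a _ → ¬a a) ∷ All.map (λ ¬b h → h λ _ b → ¬b b) ¬bs

  -- bounded depth

  -- The variable of the outermost `bd` is replaced by a formula boxed at the next point of the
  -- chain and false at `x`. Only variables up to `j` occur in `bd (suc j)`, so refutation is
  -- claimed for every `σ′` agreeing with `σ` there; this lets `σ` be extended by a new value.
  refuting : ∀ {j x} → Chain (R F) (suc j) x → Σ (ℕ → Fm) λ σ →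
    ∀ σ′ → (∀ i → i ≤ j → σ′ i ≡ σ i) → ¬ x ⊩ bd (suc j) [ σ′ ]
  refuting {zero} (_∷_ {x = x} {y} (xRy , ¬yRx) []) with separator fwd y x
  ... | A , h = (λ _ → A) , refutes
    where
    refutes : ∀ σ′ → (∀ i → i ≤ 0 → σ′ i ≡ A) → ¬ x ⊩ bd 1 [ σ′ ]
    refutes σ′ eq f rewrite eq 0 z≤n = let (□a , ¬a) = h ¬yRx in ¬a (f (dia⁺ fwd (□ A) y xRy □a))
  refuting {suc j} (_∷_ {x = x} {y} (xRy , ¬yRx) c) with separator fwd y x | refuting c
  ... | A , h | σ , refutes-y = σ⁺ , refutes-x
    where
    extend : ∀ i → Dec (i ≡ suc j) → Fm
    extend i (yes _) = A
    extend i (no _)  = σ i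

    σ⁺ : ℕ → Fm
    σ⁺ i = extend i (i ≟ suc j)

    σ⁺-old : ∀ i → i ≤ j → σ⁺ i ≡ σ i
    σ⁺-old i i≤j with i ≟ suc j
    ... | yes refl = ⊥-elim (<⇒≢ i≤j refl)
    ... | no _ = refl

    σ⁺-new : σ⁺ (suc j) ≡ A
    σ⁺-new with suc j ≟ suc j
    ... | yes _ = refl
    ... | no ¬eq = ⊥-elim (¬eq refl)

    refutes-x : ∀ σ′ → (∀ i → i ≤ suc j → σ′ i ≡ σ⁺ i) → ¬ x ⊩ bd (suc (suc j)) [ σ′ ]
    refutes-x σ′ eq f rewrite trans (eq (suc j) ≤-refl) σ⁺-new =
      let (□a , ¬a) = h ¬yRx in
      ¬a (f (dia⁺ fwd (□ A ∧' ~ bd (suc j) [ σ′ ]) y xRy λ g → g □a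
        (refutes-y σ′ λ i i≤j → trans (eq i (m≤n⇒m≤1+n i≤j)) (σ⁺-old i i≤j))))

  no-chain : ∀ d {x} → ¬ Chain (rel F d) (suc k) x
  no-chain fwd {x} c = let (σ , refutes) = refuting c in
    refutes σ (λ _ _ → refl) (instance-of (axiom BD) σ x)
  no-chain bwd c = let (y , c′) = reverse-chain c [] in
    no-chain fwd (≡-subst (λ i → Chain (R F) i y) (+-identityʳ (suc k)) c′)

  -- bounded width

  width : Dir → ℕ
  width fwd = n
  width bwd = m

  axiom-bw : ∀ d → L (bwWith (dia d) (width d))
  axiom-bw fwd = axiom BW⁺
  axiom-bw bwd = axiom BW⁻

  -- The axiom has `w + 1` variables, hence the length. Sending `p i` to a formula `σ i` true at
  -- `y i` makes its premise true at `x`, while a disjunct of its conclusion would give a point of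
  -- `σ i` that is, or accesses along `d`, a point of `σ j` with `j ≢ i`.
  no-antichain : ∀ d x ys → length ys ≡ suc (width d) → All (rel F d x) ys →
                 ¬ AllPairs (Incomparable (rel F d)) ys
  no-antichain d x ys len above inc =
    refute (Any.concatMap⁻ _ (⋁⁻ (concatMap _ (idx w)) (substitution⁺ (bwWith (dia d) w)
      (instance-of (axiom-bw d) σ x)
      (⋀⁺ (map _ (idx w)) (All.map⁺ (All.tabulate λ {i} i∈ → dia⁺ d (p i) (y i) (nth-All above (bound i∈)) (σ-holds i i∈)))))))
    where
    w = width d

    y : ℕ → W F
    y = nth x ys

    a : ℕ → ℕ → Fm
    a i j = proj₁ (separator d (y i) (y j))

    bound : ∀ {i} → i ∈ idx w → i < length ys
    bound i∈ = ≡-subst (_ <_) (sym len) (∈-upTo⁻ i∈)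

    a-separates : ∀ {i j} → i ∈ idx w → j ∈ idx w → i ≢ j → y i ⊩ bx d (a i j) × ¬ y j ⊩ a i j
    a-separates i∈ j∈ i≢j = proj₂ (separator d _ _)
      (proj₁ (nth-AllPairs (λ (p , q) → q , p) inc i≢j (bound i∈) (bound j∈)))

    -- σ i holds at y i, and a point satisfying σ i never accesses one satisfying σ j for j ≢ i.
    conjunct : ℕ → ℕ → Fm
    conjunct i j = bx d (a i j) ∧' ~ a j i

    others : ℕ → List ℕ
    others i = filter (λ j → ¬? (i ≟ j)) (idx w)

    σ : ℕ → Fm
    σ i = ⋀ (map (conjunct i) (others i))

    σ-holds : ∀ i → i ∈ idx w → y i ⊩ σ i
    σ-holds i i∈ = ⋀⁺ (map (conjunct i) (others i)) (All.map⁺ (All.tabulate λ {j} j∈others →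
      let (j∈ , i≢j) = ∈-filter⁻ (λ j → ¬? (i ≟ j)) j∈others in
      λ f → f (proj₁ (a-separates i∈ j∈ i≢j)) (proj₂ (a-separates j∈ i∈ (i≢j ∘ sym)))))

    σ-conjunct : ∀ {i j z} → j ∈ idx w → i ≢ j → z ⊩ σ i → z ⊩ bx d (a i j) × ¬ z ⊩ a j i
    σ-conjunct {i} {j} j∈ i≢j h = ∧⁻ (bx d (a i j)) (~ a j i)
      (All.lookup (⋀⁻ (map (conjunct i) (others i)) h)
        (∈-map⁺ (conjunct i) (∈-filter⁺ (λ j → ¬? (i ≟ j)) j∈ i≢j)))

    Vσ : Valuation F
    Vσ i z = z ⊩ σ i

    exclusive : ∀ {i j z z′} → i ∈ idx w → j ∈ idx w → i ≢ j → rel F d z z′ → z ⊩ σ i → ¬ z′ ⊩ σ j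
    exclusive i∈ j∈ i≢j r hi hj = proj₂ (σ-conjunct i∈ (i≢j ∘ sym) hj)
      (bx⁻ d (proj₁ (σ-conjunct j∈ i≢j hi)) _ r)

    refute : ¬ Any (λ i → Any (Vσ , x ⊩_) (map (λ j → dia d (p i ∧' (p j ∨' dia d (p j)))) (others i))) (idx w)
    refute any with find any
    ... | i , i∈ , any′ with find (Any.map⁻ any′)
    ...   | j , j∈others , h with ∈-filter⁻ (λ j → ¬? (i ≟ j)) {xs = idx w} j∈others | dia⁻ d h
    ...     | j∈ , i≢j | z , _ , h′ with ∧⁻ (p i) (p j ∨' dia d (p j)) h′
    ...       | hi , h″ with ∨⁻ (p j) (dia d (p j)) h″
    ...         | inj₁ hj = exclusive i∈ j∈ i≢j (rel-refl d) hi hj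
    ...         | inj₂ ◇hj = let (z′ , r , hj) = dia⁻ d ◇hj in exclusive i∈ j∈ i≢j r hi hj

  -- clusters

  Agree : List ℕ → W F → W F → Set
  Agree us x y = ∀ {i} → i ∈ us → (V i x → V i y) × (V i y → V i x)

  -- Points of one cluster have the same successors and predecessors, so boxed formulas agree
  -- without induction. Only variables can differ, and those outside `vs` are false everywhere.
  cluster-≈ : ∀ {x y} → R F x y → R F y x → Agree vs x y → x ≈ y
  cluster-≈ xRy yRx agree (var i) with i ∈? vs
  ... | yes i∈ = agree i∈
  ... | no i∉ = ⊥-elim ∘ vs-only i∉ _ , ⊥-elim ∘ vs-only i∉ _
  cluster-≈ xRy yRx agree ⊥' = id , id
  cluster-≈ xRy yRx agree (A ⇒ B) =
    let (f , g) = cluster-≈ xRy yRx agree A ; (f′ , g′) = cluster-≈ xRy yRx agree B in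
    (λ h → f′ ∘ h ∘ g) , (λ h → g′ ∘ h ∘ f)
  cluster-≈ xRy yRx agree (□ A) =
    (λ h z yRz → h z (R-trans xRy yRz)) , (λ h z xRz → h z (R-trans yRx xRz))
  cluster-≈ xRy yRx agree (■ A) =
    (λ h z zRy → h z (R-trans zRy yRx)) , (λ h z zRx → h z (R-trans zRx xRy))

  colour-classes : ∀ us P → FinitelyCovered (Agree us) P
  colour-classes [] P with em {Σ (W F) P}
  ... | yes (x , h) = x ∷ [] , h ∷ [] , λ _ _ → here λ ()
  ... | no ¬h = [] , [] , λ x h → ⊥-elim (¬h (x , h))
  colour-classes (i ∷ us) P = covered-∪ proj₁ proj₁ (λ _ _ → em)
    (λ { y h ¬v → h , λ v → ¬v (h , v) })
    (covered-refine (λ (_ , v) (_ , v′) → extend ((λ _ → v′) , (λ _ → v)))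
      (colour-classes us λ y → P y × V i y))
    (covered-refine (λ (_ , ¬v) (_ , ¬v′) → extend ((⊥-elim ∘ ¬v) , (⊥-elim ∘ ¬v′)))
      (colour-classes us λ y → P y × ¬ V i y))
    where
    extend : ∀ {y z} → (V i y → V i z) × (V i z → V i y) → Agree us y z → Agree (i ∷ us) y z
    extend same agree (here refl) = same
    extend same agree (there i∈) = agree i∈

  finite-clusters : ∀ d x → FinitelyCovered _≈_ (λ y → rel F d x y × rel F d y x)
  finite-clusters d x = covered-refine (same-cluster d) (colour-classes vs _)
    where
    same-cluster : ∀ d {y z} → rel F d x y × rel F d y x → rel F d x z × rel F d z x → Agree vs y z → y ≈ z
    same-cluster fwd (xy , yx) (xz , zx) = cluster-≈ (R-trans yx xz) (R-trans zx xy)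
    same-cluster bwd (yx , xy) (zx , xz) = cluster-≈ (R-trans yx xz) (R-trans zx xy)

  finite-rel : ∀ d x → FinitelyCovered _≈_ (rel F d x)
  finite-rel d = FiniteUpsets.upset-finite em (rel F d) _≈_ (rel-refl d) (rel-trans d)
    (suc k) (no-chain d) (suc (width d)) (no-antichain d) (finite-clusters d)

  Neighbour : W F → W F → Set
  Neighbour x y = R F x y ⊎ R F y x

  abstract
    finite-neighbours : ∀ x → FinitelyCovered _≈_ (Neighbour x)
    finite-neighbours x = covered-∪ inj₁ inj₂ (λ _ _ → em)
      (λ { y (inj₁ xRy) ¬xRy → ⊥-elim (¬xRy xRy) ; y (inj₂ yRx) _ → yRx })
      (finite-rel fwd x) (finite-rel bwd x)

  rel-neighbour : ∀ d {x y} → rel F d x y → Neighbour x y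
  rel-neighbour fwd = inj₁
  rel-neighbour bwd = inj₂

  rel-≈ : ∀ d {x y y′} → y ≈ y′ → rel F d x y → rel F d x y′
  rel-≈ fwd = ≈-rel bwd
  rel-≈ bwd = ≈-rel fwd

  -- generated subframes

  -- The subframe is indexed without repetitions up to ≈, since a valuation could tell repeated
  -- points apart; worlds that force the same formulas need not be propositionally equal.
  module Generated
    {I : Set} (w : I → W F) (w-injective : ∀ {i j} → w i ≈ w j → i ≡ j)
    (near : I → List I) (closed : ∀ i {y} → Neighbour (w i) y → Any (λ j → y ≈ w j) (near i))
    where

    frame : Frame
    frame = record { W = I ; R = λ i j → R F (w i) (w j) }

    open Forcing em frame using () renaming (bx⁺ to frame-bx⁺; bx⁻ to frame-bx⁻)

    frame-rel⁺ : ∀ d {i j} → rel F d (w i) (w j) → rel frame d i j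
    frame-rel⁺ fwd r = r
    frame-rel⁺ bwd r = r

    frame-rel⁻ : ∀ d {i j} → rel frame d i j → rel F d (w i) (w j)
    frame-rel⁻ fwd r = r
    frame-rel⁻ bwd r = r

    -- A formula true at the new point and false at the other listed ones corrects the value at that
    -- point alone: it is added as a disjunct, or its negation as a conjunct.
    definable : ∀ (P : I → Set) js → Σ Fm λ A → ∀ {j} → j ∈ js → (w j ⊩ A → P j) × (P j → w j ⊩ A)
    definable P [] = ⊥' , λ ()
    definable P (i ∷ js) with definable P js | em {i ∈ js}
    ... | A , def | yes i∈ = A , λ { (here refl) → def i∈ ; (there j∈) → def j∈ }
    ... | A , def | no i∉
      with separate (w i) (map w js) (λ any → i∉ (Any.map w-injective (Any.map⁻ any))) | em {P i}
    ...   | S , s , ¬s | yes pi = S ∨' A , λ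
              { (here refl) → (λ _ → pi) , (λ _ s̸ → ⊥-elim (s̸ s))
              ; (there j∈) → (λ h → proj₁ (def j∈) (h (All.lookup ¬s (∈-map⁺ w j∈)))) ,
                             (λ pj _ → proj₂ (def j∈) pj) }
    ...   | S , s , ¬s | no ¬pi = (~ S) ∧' A , λ
              { (here refl) → (λ h → ⊥-elim (h λ s̸ _ → s̸ s)) , (λ pi → ⊥-elim (¬pi pi))
              ; (there j∈) → (λ h → proj₁ (def j∈) (proj₂ (∧⁻ (~ S) A h))) ,
                             (λ pj h → h (All.lookup ¬s (∈-map⁺ w j∈)) (proj₂ (def j∈) pj)) }

    Defines : (ℕ → Fm) → Valuation frame → I → Set
    Defines σ U j = ∀ n → (w j ⊩ σ n → U n j) × (U n j → w j ⊩ σ n)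

    -- The truth value of A at i depends only on the valuation on a finite set of points.
    FiniteSupport : Valuation frame → Fm → I → Set
    FiniteSupport U A i = Σ (List I) λ js → ∀ σ → (∀ {j} → j ∈ js → Defines σ U j) →
      (w i ⊩ A [ σ ] → ⟦ A ⟧ frame U i) × (⟦ A ⟧ frame U i → w i ⊩ A [ σ ])

    -- The supports of `A` over `near i` are united, since `near i` represents all neighbours up to
    -- `≈`. `FiniteSupport` is spelled out because `(bx d A) [ σ ]` does not reduce for a variable
    -- `d`.
    bx-support : ∀ d {U A} → (∀ i → FiniteSupport U A i) → ∀ i →
      Σ (List I) λ js → ∀ σ → (∀ {j} → j ∈ js → Defines σ U j) →
      (w i ⊩ bx d (A [ σ ]) → ⟦ bx d A ⟧ frame U i) × (⟦ bx d A ⟧ frame U i → w i ⊩ bx d (A [ σ ]))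
    bx-support d {U} {A} support i = concatMap (proj₁ ∘ support) (near i) , λ σ def →
      let at : ∀ {j} → j ∈ near i → _
          at {j} j∈ = proj₂ (support j) σ
            (λ j′∈ → def (∈-concatMap⁺ (proj₁ ∘ support) (Any.map (λ { refl → j′∈ }) j∈)))
      in (λ h → frame-bx⁺ d λ j r →
            let j∈ = Any.map w-injective (closed i (rel-neighbour d (frame-rel⁻ d r))) in
            proj₁ (at j∈) (bx⁻ d h (w j) (frame-rel⁻ d r))) ,
         (λ h → bx⁺ d λ y r →
            let (j , j∈ , y≈j) = find (closed i (rel-neighbour d r)) in
            proj₂ (y≈j (A [ σ ])) (proj₂ (at j∈) (frame-bx⁻ d h j (frame-rel⁺ d (rel-≈ d y≈j r)))))

    support : ∀ U A i → FiniteSupport U A i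
    support U (var n) i = i ∷ [] , λ σ def → def (here refl) n
    support U ⊥' i = [] , λ _ _ → id , id
    support U (A ⇒ B) i with support U A i | support U B i
    ... | js , a | js′ , b = js ++ js′ , λ σ def →
      let (a⁺ , a⁻) = a σ (def ∘ ∈-++⁺ˡ) ; (b⁺ , b⁻) = b σ (def ∘ ∈-++⁺ʳ js) in
      (λ f → b⁺ ∘ f ∘ a⁻) , (λ f → b⁻ ∘ f ∘ a⁺)
    support U (□ A) = bx-support fwd {A = A} (support U A)
    support U (■ A) = bx-support bwd {A = A} (support U A)

    -- Although `U` is arbitrary, some substitution `σ` defines it on the finite support of `A` at
    -- `i`, and `A [ σ ]` is a theorem, hence true in the model.
    valid : ∀ {A} → L A → frame ⊨ A
    valid {A} a U i with support U A i
    ... | js , h = proj₁ (h σ λ j∈ n → proj₂ (definable (U n) js) j∈) (instance-of a σ (w i))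
      where
      σ : ℕ → Fm
      σ n = proj₁ (definable (U n) js)

    -- The valuation inherited from the model is defined at every point by the identity substitution
    -- `var`.
    truth : ∀ A i → ⟦ A ⟧ frame (λ n j → V n (w j)) i → w i ⊩ A
    truth A i a = substitution⁺ A (proj₂ (proj₂ (support _ A i) var λ _ _ → id , id) a)

  -- Lists without repetitions up to `≈`

  fresh : List (W F) → List (W F) → List (W F)
  keep : ∀ us y zs → Dec (Any (y ≈_) (zs ++ us)) → List (W F)
  fresh us []       = []
  fresh us (y ∷ ys) = keep us y (fresh us ys) em
  keep us y zs (yes _) = zs
  keep us y zs (no _)  = y ∷ zs

  fresh-covers : ∀ us ys {x} → Any (x ≈_) ys → Any (x ≈_) (fresh us ys ++ us)
  fresh-covers us (y ∷ ys) any with em {Any (y ≈_) (fresh us ys ++ us)} | any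
  ... | yes old | here x≈y = Any.map (≈-trans x≈y) old
  ... | yes _   | there any′ = fresh-covers us ys any′
  ... | no _    | here x≈y = here x≈y
  ... | no _    | there any′ = there (fresh-covers us ys any′)

  fresh-distinct : ∀ us ys → AllPairs (λ y z → ¬ y ≈ z) (fresh us ys)
  fresh-distinct us [] = []
  fresh-distinct us (y ∷ ys) with em {Any (y ≈_) (fresh us ys ++ us)}
  ... | yes _  = fresh-distinct us ys
  ... | no new = All.¬Any⇒All¬ _ (new ∘ Any.++⁺ˡ) ∷ fresh-distinct us ys

  fresh-new : ∀ us ys → All (λ y → ¬ Any (y ≈_) us) (fresh us ys)
  fresh-new us [] = []
  fresh-new us (y ∷ ys) with em {Any (y ≈_) (fresh us ys ++ us)}
  ... | yes _  = fresh-new us ys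
  ... | no new = (new ∘ Any.++⁺ʳ (fresh us ys)) ∷ fresh-new us ys

  fresh-All : ∀ us {P : W F → Set} {ys} → All P ys → All P (fresh us ys)
  fresh-All us [] = []
  fresh-All us {ys = y ∷ ys} (h ∷ hs) with em {Any (y ≈_) (fresh us ys ++ us)}
  ... | yes _ = fresh-All us hs
  ... | no _  = h ∷ fresh-All us hs

  distinct-lookup : ∀ {ys} → AllPairs (λ y z → ¬ y ≈ z) ys → ∀ {i j} → lookup ys i ≈ lookup ys j → i ≡ j
  distinct-lookup (_ ∷ _)  {zero}  {zero}  _ = refl
  distinct-lookup (y≉ ∷ _) {zero}  {suc j} e = ⊥-elim (All.lookup y≉ (∈-lookup j) e)
  distinct-lookup (y≉ ∷ _) {suc i} {zero}  e = ⊥-elim (All.lookup y≉ (∈-lookup i) (≈-sym e))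
  distinct-lookup (_ ∷ ds) {suc i} {suc j} e = cong suc (distinct-lookup ds e)

  lookup-covers : ∀ {y} ys → Any (y ≈_) ys → Any (λ i → y ≈ lookup ys i) (allFin (length ys))
  lookup-covers ys any = lose (∈-allFin (Any.index any)) (Any.lookup-index any)

  -- Balls around a point

  module Balls (x₀ : W F) where

    neighbours : List (W F) → List (W F)
    neighbours = concatMap (proj₁ ∘ finite-neighbours)

    -- Only worlds new up to `≈` enter the next sphere, so that the pairs in `Point` index worlds
    -- without repetition.
    sphere ball : ℕ → List (W F)
    sphere zero    = x₀ ∷ []
    sphere (suc d) = fresh (ball d) (neighbours (ball d))
    ball zero    = sphere zero
    ball (suc d) = sphere (suc d) ++ ball d

    ball-closed : ∀ d {u y} → u ∈ ball d → Neighbour u y → Any (y ≈_) (ball (suc d))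
    ball-closed d {u} {y} u∈ uy = fresh-covers (ball d) (neighbours (ball d)) (Any.concatMap⁺ (proj₁ ∘ finite-neighbours)
      (Any.map (λ { refl → proj₂ (proj₂ (finite-neighbours u)) y uy }) u∈))

    sphere⊆ball : ∀ d {y} → y ∈ sphere d → y ∈ ball d
    sphere⊆ball zero    = id
    sphere⊆ball (suc d) = ∈-++⁺ˡ

    ball-mono : ∀ {d e} → d ≤′ e → ∀ {y} → y ∈ ball d → y ∈ ball e
    ball-mono ≤′-refl y∈ = y∈
    ball-mono {e = suc e} (≤′-step d≤e) y∈ = ∈-++⁺ʳ (sphere (suc e)) (ball-mono d≤e y∈)

    sphere-distinct : ∀ d → AllPairs (λ y z → ¬ y ≈ z) (sphere d)
    sphere-distinct zero    = [] ∷ []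
    sphere-distinct (suc d) = fresh-distinct (ball d) (neighbours (ball d))

    ball-distinct : ∀ d → AllPairs (λ y z → ¬ y ≈ z) (ball d)
    ball-distinct zero    = sphere-distinct zero
    ball-distinct (suc d) = AllPairs.++⁺ (sphere-distinct (suc d)) (ball-distinct d)
      (All.map (All.¬Any⇒All¬ _) (fresh-new (ball d) (neighbours (ball d))))

    -- the whole component of x₀

    Point : Set
    Point = Σ ℕ λ d → Fin (length (sphere d))

    world : Point → W F
    world (d , i) = lookup (sphere d) i

    world∈ball : ∀ ((d , i) : Point) → world (d , i) ∈ ball d
    world∈ball (d , i) = sphere⊆ball d (∈-lookup i)

    levels-disjoint : ∀ {d e} (i : Fin (length (sphere d))) (j : Fin (length (sphere e))) →
                      d < e → ¬ world (e , j) ≈ world (d , i)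
    levels-disjoint {d} {suc e} i j (s≤s d≤e) eq = All.lookup (fresh-new (ball e) (neighbours (ball e))) (∈-lookup j)
      (Any.map (λ { refl → eq }) (ball-mono (≤⇒≤′ d≤e) (world∈ball (d , i))))

    world-injective : ∀ {i j} → world i ≈ world j → i ≡ j
    world-injective {d , i} {e , j} eq with <-cmp d e
    ... | tri< d<e _ _ = ⊥-elim (levels-disjoint i j d<e (≈-sym eq))
    ... | tri> _ _ e<d = ⊥-elim (levels-disjoint j i e<d eq)
    ... | tri≈ _ refl _ = cong (d ,_) (distinct-lookup (sphere-distinct d) eq)

    level : ℕ → List Point
    level d = map (d ,_) (allFin (length (sphere d)))

    level-covers : ∀ d {y} → Any (y ≈_) (sphere d) → Any (λ i → y ≈ world i) (level d)
    level-covers d any = Any.map⁺ (lookup-covers (sphere d) any)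

    points : ℕ → List Point
    points zero    = level zero
    points (suc d) = level (suc d) ++ points d

    points-cover : ∀ d {y} → Any (y ≈_) (ball d) → Any (λ i → y ≈ world i) (points d)
    points-cover zero any = level-covers zero any
    points-cover (suc d) any = [ (λ h → Any.++⁺ˡ (level-covers (suc d) h)) ,
      (λ h → Any.++⁺ʳ (level (suc d)) (points-cover d h)) ]′ (Any.++⁻ (sphere (suc d)) any)

    -- Neighbours of a world in `sphere d` lie, up to `≈`, in the ball of radius `d + 1`.
    module Component = Generated world world-injective (λ (d , _) → points (suc d))
      (λ (d , i) n → points-cover (suc d) (ball-closed d (world∈ball (d , i)) n))

    -- bounded zigzag depth

    Δ⁺ : ∀ {x y} A → Neighbour x y → y ⊩ A → x ⊩ Δ A
    Δ⁺ {y = y} A (inj₁ xRy) a ¬a∨◇a = ⊥-elim (¬a∨◇a λ _ → dia⁺ fwd A y xRy a)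
    Δ⁺ {y = y} A (inj₂ yRx) a _ = dia⁺ bwd A y yRx a

    Δ⁻ : ∀ {x} A → x ⊩ Δ A → Σ (W F) λ y → Neighbour x y × y ⊩ A
    Δ⁻ {x} A h with ∨⁻ (A ∨' ◇ A) (𝐏 A) h
    ... | inj₂ 𝐏a = let (y , yRx , a) = dia⁻ bwd {A = A} 𝐏a in y , inj₂ yRx , a
    ... | inj₁ h′ with ∨⁻ A (◇ A) h′
    ...   | inj₁ a = x , inj₁ R-refl , a
    ...   | inj₂ ◇a = let (y , xRy , a) = dia⁻ fwd {A = A} ◇a in y , inj₁ xRy , a

    -- `Δ^` adds `Δ` on the outside, whereas a path from `x₀` is prolonged at its far end, which
    -- corresponds to the innermost `Δ`.
    Δ^-suc : ∀ j A → Δ^ (suc j) A ≡ Δ^ j (Δ A)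
    Δ^-suc zero A = refl
    Δ^-suc (suc j) A = cong Δ (Δ^-suc j A)

    Δ^-sub : ∀ j {σ} → Δ^ j (p 0) [ σ ] ≡ Δ^ j (σ 0)
    Δ^-sub zero = refl
    Δ^-sub (suc j) = cong Δ (Δ^-sub j)

    Δ^-ball⁻ : ∀ j A → x₀ ⊩ Δ^ j A → Any (_⊩ A) (ball j)
    Δ^-ball⁻ zero A a = here a
    Δ^-ball⁻ (suc j) A h with find (Δ^-ball⁻ j (Δ A) (≡-subst (x₀ ⊩_) (Δ^-suc j A) h))
    ... | u , u∈ , Δa = let (y , uy , a) = Δ⁻ A Δa in
      Any.map (λ y≈z → proj₁ (y≈z A) a) (ball-closed j u∈ uy)

    -- All `A` are treated at once, as the induction hypothesis is applied to `Δ A`. Worlds already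
    -- in `ball j` absorb the extra `Δ` by reflexivity.
    Δ^-ball⁺ : ∀ j → All (λ u → ∀ A → u ⊩ A → x₀ ⊩ Δ^ j A) (ball j)
    Δ^-ball⁺ zero = (λ _ → id) ∷ []
    Δ^-ball⁺ (suc j) = All.++⁺
      (fresh-All (ball j) (All.concat⁺ (All.map⁺ (All.map
        (λ {u} reach → All.map (λ uy A a → ≡-subst (x₀ ⊩_) (sym (Δ^-suc j A)) (reach (Δ A) (Δ⁺ A uy a)))
          (proj₁ (proj₂ (finite-neighbours u)))) (Δ^-ball⁺ j)))))
      (All.map (λ reach A a → Δ⁺ (Δ^ j A) (inj₁ R-refl) (reach A a)) (Δ^-ball⁺ j))

    module Bounded (r : ℕ) (axiom-bz : L (bz (just r))) where

      -- A neighbour `y` outside the ball would satisfy some `A` false throughout `ball r`. Then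
      -- `Δ^ (suc r) A` holds at `x₀`, by `bz` so does `Δ^ r A`, and this puts a point of `A` into
      -- the ball.
      ball-stable : ∀ {u y} → u ∈ ball r → Neighbour u y → Any (y ≈_) (ball r)
      ball-stable {u} {y} u∈ uy = decidable-stable em λ y∉ →
        let (A , a , ¬as) = separate y (ball r) y∉
            h = instance-of axiom-bz (λ _ → A) x₀
              (≡-subst (x₀ ⊩_) (trans (sym (Δ^-suc r A)) (sym (Δ^-sub (suc r))))
                (All.lookup (Δ^-ball⁺ r) u∈ (Δ A) (Δ⁺ A uy a)))
        in All.All¬⇒¬Any ¬as (Δ^-ball⁻ r A (≡-subst (x₀ ⊩_) (Δ^-sub r) h))

      module FiniteComponent = Generated (lookup (ball r)) (distinct-lookup (ball-distinct r))
        (λ _ → allFin (length (ball r))) (λ i n → lookup-covers (ball r) (ball-stable (∈-lookup i) n))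

-- The countermodel to a non-theorem

vars : Fm → List ℕ
vars (var i) = i ∷ []
vars ⊥'      = []
vars (A ⇒ B) = vars A ++ vars B
vars (□ A)   = vars A
vars (■ A)   = vars A

falsify-outside : List ℕ → ℕ → Fm
falsify-outside us i with i ∈? us
... | yes _ = var i
... | no _  = ⊥'

falsify-outside-id : ∀ A {us} → (∀ {i} → i ∈ vars A → i ∈ us) → A [ falsify-outside us ] ≡ A
falsify-outside-id (var i) {us} ⊆us with i ∈? us
... | yes _ = refl
... | no i∉ = ⊥-elim (i∉ (⊆us (here refl)))
falsify-outside-id ⊥' ⊆us = refl
falsify-outside-id (A ⇒ B) ⊆us = cong₂ _⇒_ (falsify-outside-id A (⊆us ∘ ∈-++⁺ˡ))
                                           (falsify-outside-id B (⊆us ∘ ∈-++⁺ʳ (vars A)))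
falsify-outside-id (□ A) ⊆us = cong □ (falsify-outside-id A ⊆us)
falsify-outside-id (■ A) ⊆us = cong ■ (falsify-outside-id A ⊆us)

module Countermodel
  (em : ExcludedMiddle 0ℓ)
  {k n m : ℕ} {l : Maybe ℕ} {L : Fm → Set} (ext : NExt (S4BPAx (suc k) l n m) L)
  (A : Fm) (¬LA : ¬ L A)
  where

  normal : NormalTenseLogic L
  normal = proj₁ ext

  τ : ℕ → Fm
  τ = falsify-outside (vars A)

  L-subst : ∀ {B} → L B → L (B [ τ ])
  L-subst b = NormalTenseLogic.subst normal _ τ b

  L-nec : ∀ d {B} → L (B [ τ ]) → L (bx d B [ τ ])
  L-nec fwd = NormalTenseLogic.nec□ normal _
  L-nec bwd = NormalTenseLogic.nec■ normal _

  -- Substitution commutes with connectives and boxes, so the rules of `L` pass to this set. The set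
  -- need not be closed under substitution, which is why `Canonical` asks only for axioms, `mp` and
  -- necessitation.
  open Canonical em (λ B → L (B [ τ ]))
    (λ a → L-subst (NormalTenseLogic.axioms normal _ a)) (NormalTenseLogic.mp normal _ _) L-nec
  open World

  falsified : ∀ {i} → i ∉ vars A → ∀ x → ¬ x ∋ var i
  falsified {i} i∉ x h = ∌⊥ x (∋-app x (∋-thm x refutable) h)
    where
    refutable : L (~ τ i)
    refutable with i ∈? vars A
    ... | yes i∈ = ⊥-elim (i∉ i∈)
    ... | no _   = Λ-id {⊥'}

  -- Inconsistency of `~ A` would put `(~ ~ A) [ τ ]` into `L`, hence `A [ τ ]`, which is `A`.
  refuting-world : Σ World λ x → x ∋ ~ A
  refuting-world =
    let (x , h) = lindenbaum (theorems ▷ (~ A)) λ ¬¬a →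
          ¬LA (≡-subst L (falsify-outside-id A id)
            (NormalTenseLogic.mp normal _ _ (L-subst (NormalTenseLogic.axioms normal _ (ax-DN A))) ¬¬a))
    in x , h (Λ-id {~ A})

  x₀ : World
  x₀ = proj₁ refuting-world

  open TightModel em normal (λ a → proj₂ ext _ (KtPlus.gen a)) canonicalFrame canonicalValuation
    (λ {B} b x → truth⁻ B x (∋-thm x (L-subst b)))
    (λ {x} {y} h B □b → truth⁺ B y (h B (truth⁻ (□ B) x □b)))
    (vars A) falsified public
  open Balls x₀ public

  x₀⊮A : ¬ x₀ ⊩ A
  x₀⊮A a = ∌⊥ x₀ (∋-app x₀ (proj₂ refuting-world) (truth⁺ A x₀ a))

  component-refutes : ¬ Component.frame ⊨ A
  -- `sphere zero` consists of `x₀` alone, so `(0 , zero)` is `x₀`.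
  component-refutes valid = x₀⊮A (Component.truth A (0 , zero) (valid _ _))

  module FiniteRefutation (r : ℕ) (axiom-bz : L (bz (just r))) where

    open Bounded r axiom-bz public

    finite-component-refutes : ¬ FiniteComponent.frame ⊨ A
    -- The position of `x₀` in `ball r` varies with `r` and is read off from the membership proof.
    finite-component-refutes valid = x₀⊮A (≡-subst (_⊩ A) (sym (Any.lookup-index x₀∈))
      (FiniteComponent.truth A (Any.index x₀∈) (valid _ _)))
      where
      x₀∈ : x₀ ∈ ball r
      x₀∈ = ball-mono {e = r} z≤′n (here refl)

theorem4p9 : ExcludedMiddle 0ℓ →
    (n m k l : ℕ) → 1 ≤ n → 1 ≤ m → 1 ≤ k → 1 ≤ l →
    ((L : Fm → Set) → NExt (S4BPAx k nothing n m) L → KripkeComplete L)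
    × ((L : Fm → Set) → NExt (S4BPAx k (just l) n m) L → FMP L)
theorem4p9 em n m (suc k) l _ _ _ _ = kripke-complete , finite-model-property
  where
  kripke-complete : (L : Fm → Set) → NExt (S4BPAx (suc k) nothing n m) L → KripkeComplete L
  -- With all frames validating `L` in the class, soundness is immediate and completeness needs one
  -- refuting frame per non-theorem.
  kripke-complete L ext = (λ F → ∀ B → L B → F ⊨ B) , λ A →
    (λ a F valid → valid A a) ,
    (λ h → decidable-stable em λ ¬a → let open Countermodel em ext A ¬a in
      component-refutes (h Component.frame λ _ → Component.valid))

  finite-model-property : (L : Fm → Set) → NExt (S4BPAx (suc k) (just l) n m) L → FMP L
  finite-model-property L ext = (λ F → FiniteFrame F × (∀ B → L B → F ⊨ B)) , (λ F → proj₁) , λ A →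
    (λ a F (_ , valid) → valid A a) ,
    (λ h → decidable-stable em λ ¬a →
      let open Countermodel em ext A ¬a
          open FiniteRefutation l (proj₂ ext _ (KtPlus.gen BZ))
      in finite-component-refutes (h FiniteComponent.frame ((_ , ↔-id _) , λ _ → FiniteComponent.valid)))
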